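{- For each $k \in \mathbb{N}$, every (finite) graph $G$ with list chromatic number $\chi_\ell(G) \ge 4k+1$ contains a subgraph $H$ with both connectivity $\kappa(H) \ge k$ and list chromatic number $\chi_\ell(H) \ge k$.
   Context: $\chi_\ell$ denotes list chromatic number (choosability) and $\kappa$ denotes vertex connectivity. -}

module Defs where

open import Data.Nat using (ℕ; _<_; _≤_)
open import Data.Empty using (⊥)
open import Data.Bool using (Bool; T)
open import Data.Fin using (Fin)
open import Data.Fin.Subset using (Subset; _∉_; ∣_∣)
open import Data.List using (List; length)
open import Data.List.Membership.Propositional using (_∈_)
open import Data.List.Relation.Unary.Unique.Propositional using (Unique)
open import Data.Product using (Σ; _×_)
open import Function.Definitions using (Injective)
open import Relation.Binary.PropositionalEquality using (_≡_; _≢_)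

record Graph : Set where
  field
    n      : ℕ
    adj    : Fin n → Fin n → Bool
    sym    : ∀ u v → T (adj u v) → T (adj v u)
    irrefl : ∀ v → T (adj v v) → ⊥
open Graph public

data Walk (G : Graph) (X : Subset (n G)) : Fin (n G) → Fin (n G) → Set where
  here : ∀ {u} → Walk G X u u
  step : ∀ {u v w} → T (adj G u v) → v ∉ X → Walk G X v w → Walk G X u w

ConnectedWithout : (G : Graph) → Subset (n G) → Set
ConnectedWithout G X = ∀ u v → u ∉ X → v ∉ X → Walk G X u v

-- k-connected (Diestel): |G| > k and G − X connected for every X with |X| < k.
-- κ(G) ≥ k  iff  G is k-connected.
KConnected : Graph → ℕ → Set
KConnected G k = (k < n G) × (∀ (X : Subset (n G)) → ∣ X ∣ < k → ConnectedWithout G X)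

Choosable : Graph → ℕ → Set
Choosable G k =
  (L : Fin (n G) → List ℕ) →
  (∀ v → (length (L v) ≡ k) × Unique (L v)) →
  Σ (Fin (n G) → ℕ) λ c →
    (∀ v → c v ∈ L v) × (∀ u v → T (adj G u v) → c u ≢ c v)

-- χ_ℓ(G) ≥ m : χ_ℓ(G) is the least k with G k-choosable, so every such k is ≥ m.
ListChromatic≥ : Graph → ℕ → Set
ListChromatic≥ G m = ∀ k → Choosable G k → m ≤ k

-- H is (isomorphic to) a subgraph of G: an injective vertex map preserving edges.
Subgraph : Graph → Graph → Set
Subgraph H G =
  Σ (Fin (n H) → Fin (n G)) λ f →
    Injective _≡_ _≡_ f × (∀ u v → T (adj H u v) → T (adj G (f u) (f v)))

{-# OPTIONS --safe #-}

-- Suppose no induced subgraph of G is k-connected and not (k-1)-choosable.  We colour G from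
-- lists of size 4k by proving a stronger extension statement: some vertices are precoloured,
-- the others ("free") have lists of size at least 3k, and the total weight is at most 2k²,
-- where a precoloured vertex weighs k and a free vertex weighs the deficit 4k - |L|.
--  * A free vertex with deficit k can be coloured at no cost in weight.
--  * A precoloured vertex with fewer than k free neighbours can be deleted, its colour being
--    struck from their lists: it weighs at least as much as the deficits it creates.
--  * Otherwise, if the current graph has a separator X of size < k, both sides contain a free
--    vertex.  One side has weight at most k².  Colour everything but its free vertices, then
--    colour that side with X precoloured: the weight is at most k² + k·|X| ≤ 2k².
--  * If there is no such separator, the current graph is small, or it is k-connected and hence
--    (k-1)-choosable; at most 2k vertices are precoloured, so lists of size k remain after
--    removing their colours.
-- The search for the subgraph is effective because the colours occurring in a list assignment
-- can be renamed into a palette whose size depends only on G and k.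
module Submission where

open import Defs
open import Data.Nat using (ℕ; zero; suc; _+_; _*_; _∸_; _⊓_; _≤_; _<_; z≤n; s≤s; _≤?_; _<?_)
import Data.Nat.Properties as ℕ
open import Algebra.Properties.Semiring.Sum ℕ.+-*-semiring using (sum; ∑-distrib-+; *-distribʳ-sum; sum-replicate-zero)
open import Data.Bool using (Bool; true; false; T; not; _∧_; if_then_else_)
import Data.Bool.Properties as Bool
open import Data.Empty using (⊥-elim)
open import Data.Fin using (Fin; zero; suc; toℕ; cast; inject≤; combine; remQuot; finToFun; funToFin)
import Data.Fin.Properties as Fin
open import Data.Fin.Subset using (Subset; _∈_; _∉_; ∣_∣; _-_; _∪_; ⁅_⁆; ⊤)
import Data.Fin.Subset.Properties as Subset
open import Data.List using (List; []; _∷_; length)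
import Data.List as List
import Data.List.Properties as List
open import Data.List.Membership.Propositional using () renaming (_∈_ to _∈ˡ_)
import Data.List.Membership.Propositional.Properties as List∈
open import Data.List.Relation.Unary.All using ([]; _∷_)
import Data.List.Relation.Unary.All as All
import Data.List.Relation.Unary.Any as Any
import Data.List.Relation.Unary.Any.Properties as AnyP
open import Data.List.Relation.Unary.AllPairs using ([]; _∷_)
open import Data.List.Relation.Unary.Any using (here; there)
open import Data.List.Relation.Unary.Unique.Propositional using (Unique)
import Data.List.Relation.Unary.Unique.Propositional.Properties as Unique
open import Data.Maybe using (Maybe; just; nothing; is-just; fromMaybe)
open import Data.Product using (Σ; ∃; _×_; _,_; proj₁; proj₂; uncurry)
open import Data.Sum using (inj₁; inj₂)
open import Data.Unit using (tt) renaming (⊤ to Unit)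
open import Data.Vec using ([]; _∷_; lookup; tabulate)
open import Data.Vec.Base using (here; there)
import Data.Vec.Properties as Vec
open import Function using (_∘_; id; case_of_)
open import Function.Definitions using (Injective)
open import Relation.Binary.PropositionalEquality using (_≡_; _≢_; _≗_; refl; cong; subst; trans)
import Relation.Binary.PropositionalEquality as ≡
open import Relation.Nullary using (¬_; Dec; yes; no; does; contradiction)
open import Relation.Nullary.Decidable using (map′; _×-dec_; _→-dec_; ¬?; decidable-stable; dec-true)

-- Finite sums

indicator : Bool → ℕ
indicator b = if b then 1 else 0

sum-mono : ∀ {m} {f g : Fin m → ℕ} → (∀ i → f i ≤ g i) → sum f ≤ sum g
sum-mono {zero}  f≤g = z≤n
sum-mono {suc m} f≤g = ℕ.+-mono-≤ (f≤g zero) (sum-mono (f≤g ∘ suc))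

sum-mono-< : ∀ {m} {f g : Fin m → ℕ} → (∀ i → f i ≤ g i) →
             ∀ i → f i < g i → sum f < sum g
sum-mono-< f≤g zero    f<g = ℕ.+-mono-<-≤ f<g (sum-mono (f≤g ∘ suc))
sum-mono-< f≤g (suc i) f<g = ℕ.+-mono-≤-< (f≤g zero) (sum-mono-< (f≤g ∘ suc) i f<g)

term≤sum : ∀ {m} (f : Fin m → ℕ) i → f i ≤ sum f
term≤sum f zero    = ℕ.m≤m+n _ _
term≤sum f (suc i) = ℕ.≤-trans (term≤sum (f ∘ suc) i) (ℕ.m≤n+m _ _)

∣p∣≡sum : ∀ {m} (p : Subset m) → ∣ p ∣ ≡ sum (indicator ∘ lookup p)
∣p∣≡sum []          = refl
∣p∣≡sum (true  ∷ p) = cong suc (∣p∣≡sum p)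
∣p∣≡sum (false ∷ p) = ∣p∣≡sum p

∣tabulate∣≡sum : ∀ {m} (b : Fin m → Bool) → ∣ tabulate b ∣ ≡ sum (indicator ∘ b)
∣tabulate∣≡sum {zero}  b = refl
∣tabulate∣≡sum {suc m} b with b zero
... | true  = cong suc (∣tabulate∣≡sum (b ∘ suc))
... | false = ∣tabulate∣≡sum (b ∘ suc)

-- Subsets of Fin m

∈⇒lookup : ∀ {m} {x : Fin m} {p : Subset m} → x ∈ p → lookup p x ≡ true
∈⇒lookup = Vec.[]=⇒lookup

lookup⇒∈ : ∀ {m} {x : Fin m} {p : Subset m} → lookup p x ≡ true → x ∈ p
lookup⇒∈ {x = x} {p} = Vec.lookup⇒[]= x p

∉⇒lookup : ∀ {m} {x : Fin m} {p : Subset m} → x ∉ p → lookup p x ≡ false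
∉⇒lookup x∉p = Bool.¬-not (x∉p ∘ lookup⇒∈)

lookup⇒∉ : ∀ {m} {x : Fin m} {p : Subset m} → lookup p x ≡ false → x ∉ p
lookup⇒∉ eq x∈p = case trans (≡.sym eq) (∈⇒lookup x∈p) of λ ()

∈-tabulate : ∀ {m} {b : Fin m → Bool} {x} → b x ≡ true → x ∈ tabulate b
∈-tabulate {b = b} {x} bx = lookup⇒∈ (trans (Vec.lookup∘tabulate b x) bx)

∈-tabulate⁻ : ∀ {m} {b : Fin m → Bool} {x} → x ∈ tabulate b → b x ≡ true
∈-tabulate⁻ {b = b} {x} x∈ = trans (≡.sym (Vec.lookup∘tabulate b x)) (∈⇒lookup x∈)

x∉p-x : ∀ {m} (p : Subset m) x → x ∉ p - x
x∉p-x (_ ∷ p) zero    ()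
x∉p-x (_ ∷ p) (suc x) (there x∈) = x∉p-x p x x∈

∣p∣≤1+∣p-x∣ : ∀ {m} (p : Subset m) x → ∣ p ∣ ≤ suc ∣ p - x ∣
∣p∣≤1+∣p-x∣ (true  ∷ p) zero    = s≤s (ℕ.≤-reflexive (cong ∣_∣ (≡.sym (Subset.p─⊥≡p p))))
∣p∣≤1+∣p-x∣ (false ∷ p) zero    = ℕ.m≤n⇒m≤1+n (ℕ.≤-reflexive (cong ∣_∣ (≡.sym (Subset.p─⊥≡p p))))
∣p∣≤1+∣p-x∣ (true  ∷ p) (suc x) = s≤s (∣p∣≤1+∣p-x∣ p x)
∣p∣≤1+∣p-x∣ (false ∷ p) (suc x) = ∣p∣≤1+∣p-x∣ p x

Unique⇒length≤∣p∣ : ∀ {m} {xs : List (Fin m)} {p : Subset m} →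
                    Unique xs → (∀ {x} → x ∈ˡ xs → x ∈ p) → length xs ≤ ∣ p ∣
Unique⇒length≤∣p∣ []          xs⊆p = z≤n
Unique⇒length≤∣p∣ (x∉xs ∷ u) xs⊆p = ℕ.≤-<-trans
  (Unique⇒length≤∣p∣ u λ y∈xs →
    Subset.x∈p∧x≢y⇒x∈p-y (xs⊆p (there y∈xs)) (All.lookup x∉xs y∈xs ∘ ≡.sym))
  (Subset.x∈p⇒∣p-x∣<∣p∣ (xs⊆p (here refl)))

0<∣p∣⇒nonempty : ∀ {m} (p : Subset m) → 0 < ∣ p ∣ → ∃ (_∈ p)
0<∣p∣⇒nonempty (true  ∷ p) 0<∣p∣ = zero , here
0<∣p∣⇒nonempty (false ∷ p) 0<∣p∣ with x , x∈p ← 0<∣p∣⇒nonempty p 0<∣p∣ = suc x , there x∈p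

-- Choosing a colour outside a few forbidden ones.

avoid : ∀ {m c} → (Fin m → Maybe (Fin c)) → Subset c → Subset c
avoid {zero}  f p = p
avoid {suc m} f p with f zero
... | just x  = avoid (f ∘ suc) p - x
... | nothing = avoid (f ∘ suc) p

avoid⊆ : ∀ {m c} (f : Fin m → Maybe (Fin c)) p {x} → x ∈ avoid f p → x ∈ p
avoid⊆ {zero}  f p x∈ = x∈
avoid⊆ {suc m} f p x∈ with f zero
... | just y  = avoid⊆ (f ∘ suc) p (Subset.p─q⊆p _ ⁅ y ⁆ x∈)
... | nothing = avoid⊆ (f ∘ suc) p x∈

∉avoid : ∀ {m c} (f : Fin m → Maybe (Fin c)) p i {x} → f i ≡ just x → x ∉ avoid f p
∉avoid f p zero    fi x∈ with f zero
∉avoid f p zero    refl x∈ | just y = x∉p-x _ y x∈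
∉avoid f p (suc i) fi x∈ with f zero
... | just y  = ∉avoid (f ∘ suc) p i fi (Subset.p─q⊆p _ ⁅ y ⁆ x∈)
... | nothing = ∉avoid (f ∘ suc) p i fi x∈

∣p∣≤∣avoid∣ : ∀ {m c} (f : Fin m → Maybe (Fin c)) p →
              ∣ p ∣ ≤ sum (indicator ∘ is-just ∘ f) + ∣ avoid f p ∣
∣p∣≤∣avoid∣ {zero}  f p = ℕ.≤-refl
∣p∣≤∣avoid∣ {suc m} f p with f zero
... | nothing = ∣p∣≤∣avoid∣ (f ∘ suc) p
... | just x  = begin
  ∣ p ∣                          ≤⟨ ∣p∣≤∣avoid∣ (f ∘ suc) p ⟩
  s + ∣ q ∣                      ≤⟨ ℕ.+-monoʳ-≤ s (∣p∣≤1+∣p-x∣ q x) ⟩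
  s + suc ∣ q - x ∣              ≡⟨ ℕ.+-suc s _ ⟩
  suc (s + ∣ q - x ∣)            ∎
  where
  open ℕ.≤-Reasoning
  q = avoid (f ∘ suc) p
  s = sum (indicator ∘ is-just ∘ f ∘ suc)

-- Each index where `f` is defined removes at most one element of `p`, whether or not values repeat,
-- so something survives.
pick-avoiding : ∀ {m c} (f : Fin m → Maybe (Fin c)) p → sum (indicator ∘ is-just ∘ f) < ∣ p ∣ →
                ∃ λ x → x ∈ p × (∀ i → f i ≢ just x)
pick-avoiding f p few
  with x , x∈ ← 0<∣p∣⇒nonempty (avoid f p) (ℕ.+-cancelˡ-< _ 0 _
    (ℕ.<-≤-trans (subst (_< ∣ p ∣) (≡.sym (ℕ.+-identityʳ _)) few) (∣p∣≤∣avoid∣ f p)))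
  = x , avoid⊆ f p x∈ , λ i fi → ∉avoid f p i fi x∈

-- Numbering the elements of a subset.

embed : ∀ {m} (p : Subset m) → Fin ∣ p ∣ → Fin m
embed (true  ∷ p) zero    = zero
embed (true  ∷ p) (suc i) = suc (embed p i)
embed (false ∷ p) i       = suc (embed p i)

embed-∈ : ∀ {m} (p : Subset m) i → embed p i ∈ p
embed-∈ (true  ∷ p) zero    = here
embed-∈ (true  ∷ p) (suc i) = there (embed-∈ p i)
embed-∈ (false ∷ p) i       = there (embed-∈ p i)

embed-injective : ∀ {m} (p : Subset m) → Injective _≡_ _≡_ (embed p)
embed-injective (true  ∷ p) {zero}  {zero}  eq = refl
embed-injective (true  ∷ p) {suc i} {suc j} eq = cong suc (embed-injective p (Fin.suc-injective eq))
embed-injective (false ∷ p) eq = embed-injective p (Fin.suc-injective eq)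

embed-surjective : ∀ {m} (p : Subset m) {x} → x ∈ p → ∃ λ i → embed p i ≡ x
embed-surjective (true  ∷ p) here = zero , refl
embed-surjective (true  ∷ p) (there x∈p) with i , refl ← embed-surjective p x∈p = suc i , refl
embed-surjective (false ∷ p) (there x∈p) with i , refl ← embed-surjective p x∈p = i , refl

-- The image of `q` under `embed p`. It keeps the cardinality, so a separator of an induced subgraph
-- is no larger when viewed in the whole graph.
push : ∀ {m} (p : Subset m) → Subset ∣ p ∣ → Subset m
push []          q       = []
push (true  ∷ p) (b ∷ q) = b ∷ push p q
push (false ∷ p) q       = false ∷ push p q

∣push∣ : ∀ {m} (p : Subset m) q → ∣ push p q ∣ ≡ ∣ q ∣
∣push∣ []          []          = refl
∣push∣ (true  ∷ p) (true  ∷ q) = cong suc (∣push∣ p q)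
∣push∣ (true  ∷ p) (false ∷ q) = ∣push∣ p q
∣push∣ (false ∷ p) q           = ∣push∣ p q

lookup-push : ∀ {m} (p : Subset m) q i → lookup (push p q) (embed p i) ≡ lookup q i
lookup-push (true  ∷ p) (b ∷ q) zero    = refl
lookup-push (true  ∷ p) (b ∷ q) (suc i) = lookup-push p q i
lookup-push (false ∷ p) q       i       = lookup-push p q i

-- Quantification over functions between finite sets

-- Functions are enumerated through their codes in a finite type. Decoding a code recovers a
-- function only pointwise, hence the hypothesis `resp`.
anyFun? : ∀ {m c} {P : (Fin m → Fin c) → Set} → (∀ {f g} → f ≗ g → P f → P g) →
          (∀ f → Dec (P f)) → Dec (∃ P)
anyFun? {m} {c} resp P? = map′
  (λ (i , Pi) → finToFun i , Pi)
  (λ (f , Pf) → funToFin f , resp (≡.sym ∘ Fin.finToFun-funToFin f) Pf)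
  (Fin.any? λ i → P? (finToFun {c} {m} i))

allFun? : ∀ {m c} {P : (Fin m → Fin c) → Set} → (∀ {f g} → f ≗ g → P f → P g) →
          (∀ f → Dec (P f)) → Dec (∀ f → P f)
allFun? {m} {c} resp P? = map′
  (λ all f → resp (Fin.finToFun-funToFin f) (all (funToFin f)))
  (λ all i → all (finToFun i))
  (Fin.all? λ i → P? (finToFun {c} {m} i))

-- Graphs

induced : (G : Graph) → Subset (n G) → Graph
induced G W = record
  { n      = ∣ W ∣
  ; adj    = λ i j → adj G (embed W i) (embed W j)
  ; sym    = λ i j → sym G _ _
  ; irrefl = λ i → irrefl G _
  }

induced-Subgraph : ∀ G W → Subgraph (induced G W) G
induced-Subgraph G W = embed W , embed-injective W , λ _ _ e → e

-- A colouring from the first `i` entries of each list is a colouring from the lists.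
Choosable-mono : ∀ {H i j} → i ≤ j → Choosable H i → Choosable H j
Choosable-mono {i = i} {j} i≤j choose L lists
  with c , c∈ , proper ← choose (List.take i ∘ L) (λ v →
    trans (List.length-take i (L v)) (trans (cong (i ⊓_) (proj₁ (lists v))) (ℕ.m≤n⇒m⊓n≡m i≤j)) ,
    Unique.take⁺ i (proj₂ (lists v)))
  = c , (λ v → List∈take (L v) (c∈ v)) , proper
  where
  List∈take : ∀ {x} (xs : List ℕ) → x ∈ˡ List.take i xs → x ∈ˡ xs
  List∈take xs x∈ = subst (_ ∈ˡ_) (List.take++drop≡id i xs) (List∈.∈-++⁺ˡ x∈)

-- Lists of length j over the palette Fin N, flattened to one function so that
-- they can be enumerated.
ChoosableFrom : ℕ → Graph → ℕ → Set
ChoosableFrom N H j = (L : Fin (n H * j) → Fin N) →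
  (∀ (v : Fin (n H)) (a b : Fin j) → L (combine v a) ≡ L (combine v b) → a ≡ b) →
  ∃ λ (s : Fin (n H) → Fin j) →
    ∀ u v → T (adj H u v) → L (combine u (s u)) ≢ L (combine v (s v))

choosableFrom? : ∀ N H j → Dec (ChoosableFrom N H j)
choosableFrom? N H j = allFun?
  (λ {f} {g} f≗g choose inj →
    let s , proper = choose λ v a b eq → inj v a b (trans (≡.sym (f≗g _)) (trans eq (f≗g _)))
    in s , λ u v e eq → proper u v e (trans (f≗g _) (trans eq (≡.sym (f≗g _)))))
  λ L →
    (Fin.all? λ (v : Fin (n H)) → Fin.all? λ (a : Fin j) → Fin.all? λ b →
      (L (combine v a) Fin.≟ L (combine v b)) →-dec (a Fin.≟ b))
    →-dec
    anyFun? {P = λ s → ∀ u v → T (adj H u v) → L (combine u (s u)) ≢ L (combine v (s v))}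
      (λ {f} {g} f≗g proper u v e eq → proper u v e
        (trans (cong (L ∘ combine u) (f≗g u)) (trans eq (cong (L ∘ combine v) (≡.sym (f≗g v))))))
      λ s → Fin.all? λ u → Fin.all? λ v →
        Bool.T? (adj H u v) →-dec ¬? (L (combine u (s u)) Fin.≟ L (combine v (s v)))

Choosable⇒ChoosableFrom : ∀ {N H j} → Choosable H j → ChoosableFrom N H j
Choosable⇒ChoosableFrom {N} {H} {j} choose L inj
  with c , c∈ , proper ← choose (λ v → List.tabulate (toℕ ∘ L ∘ combine v)) (λ v →
    List.length-tabulate _ , Unique.tabulate⁺ (inj v _ _ ∘ Fin.toℕ-injective))
  = (λ v → proj₁ (List∈.∈-tabulate⁻ (c∈ v))) ,
    λ u v e eq → proper u v e (trans (proj₂ (List∈.∈-tabulate⁻ (c∈ u)))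
      (trans (cong toℕ eq) (≡.sym (proj₂ (List∈.∈-tabulate⁻ (c∈ v))))))

-- `X` separates `C` from its complement; what `C` does inside `X` is immaterial. Edges are
-- symmetric, so closure in one direction suffices. Boolean lookups keep every clause decidable.
Cut : Graph → ℕ → Set
Cut H k = ∃ λ (X : Subset (n H)) → ∃ λ (C : Subset (n H)) → ∣ X ∣ < k ×
  (∃ λ u → lookup X u ≡ false × lookup C u ≡ true) ×
  (∃ λ v → lookup X v ≡ false × lookup C v ≡ false) ×
  (∀ a b → T (adj H a b) → lookup X a ≡ false → lookup X b ≡ false →
    lookup C a ≡ true → lookup C b ≡ true)

cut? : ∀ H k → Dec (Cut H k)
cut? H k = Subset.anySubset? λ X → Subset.anySubset? λ C →
  (∣ X ∣ <? k) ×-dec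
  (Fin.any? λ u → (lookup X u Bool.≟ false) ×-dec (lookup C u Bool.≟ true)) ×-dec
  (Fin.any? λ v → (lookup X v Bool.≟ false) ×-dec (lookup C v Bool.≟ false)) ×-dec
  (Fin.all? λ a → Fin.all? λ b → Bool.T? (adj H a b) →-dec ((lookup X a Bool.≟ false) →-dec
    ((lookup X b Bool.≟ false) →-dec ((lookup C a Bool.≟ true) →-dec (lookup C b Bool.≟ true)))))

snoc : ∀ {H X u v w} → Walk H X u v → T (adj H v w) → w ∉ X → Walk H X u w
snoc here         e w∉X = step e w∉X here
snoc (step f x p) e w∉X = step f x (snoc p e w∉X)

-- The set reached from `u` grows one vertex at a time until it contains `v`; if it stalls earlier,
-- it is one side of a cut.
¬Cut⇒ConnectedWithout : ∀ {H k} → ¬ Cut H k → ∀ X → ∣ X ∣ < k → ConnectedWithout H X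
¬Cut⇒ConnectedWithout {H} {k} ¬cut X small u v u∉X v∉X =
  grow (suc (n H)) ⁅ u ⁆ (ℕ.m≤n+m _ _) (Subset.x∈⁅x⁆ u)
    (λ i i∈ → subst (Walk H X u) (≡.sym (Subset.x∈⁅y⁆⇒x≡y u i∈)) here)
  where
  -- `∣ C ∣ + m` stays above `n H` because `C` gains a vertex whenever `m` drops; the fuel cannot
  -- run out, as `∣ C ∣` is at most `n H`.
  grow : ∀ m (C : Subset (n H)) → n H < ∣ C ∣ + m → u ∈ C →
         (∀ i → i ∈ C → Walk H X u i) → Walk H X u v
  grow zero C fuel u∈C reach =
    contradiction (subst (n H <_) (ℕ.+-identityʳ _) fuel) (ℕ.≤⇒≯ (Subset.∣p∣≤n C))
  grow (suc m) C fuel u∈C reach with v Subset.∈? C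
  ... | yes v∈C = reach v v∈C
  ... | no  v∉C with Fin.any? (λ a → Fin.any? λ b → (a Subset.∈? C) ×-dec
                  Bool.T? (adj H a b) ×-dec ¬? (b Subset.∈? X) ×-dec ¬? (b Subset.∈? C))
  ...   | no stuck = contradiction
    (X , C , small , (u , ∉⇒lookup u∉X , ∈⇒lookup u∈C) , (v , ∉⇒lookup v∉X , ∉⇒lookup v∉C) ,
     λ a b e _ b∉X a∈C → ∈⇒lookup (decidable-stable (b Subset.∈? C) λ b∉C →
       stuck (a , b , lookup⇒∈ a∈C , e , lookup⇒∉ b∉X , b∉C))) ¬cut
  ...   | yes (a , b , a∈C , e , b∉X , b∉C) = grow m (C ∪ ⁅ b ⁆)
    (ℕ.<-≤-trans fuel (ℕ.≤-trans (ℕ.≤-reflexive (ℕ.+-suc ∣ C ∣ m)) (ℕ.+-monoˡ-≤ m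
      (Subset.p⊂q⇒∣p∣<∣q∣ (Subset.p⊆p∪q ⁅ b ⁆ , b , Subset.q⊆p∪q C ⁅ b ⁆ (Subset.x∈⁅x⁆ b) , b∉C)))))
    (Subset.p⊆p∪q ⁅ b ⁆ u∈C)
    λ i i∈ → case Subset.x∈p∪q⁻ C ⁅ b ⁆ i∈ of λ where
      (inj₁ i∈C) → reach i i∈C
      (inj₂ i∈b) → subst (Walk H X u) (≡.sym (Subset.x∈⁅y⁆⇒x≡y b i∈b)) (snoc (reach a a∈C) e b∉X)

-- Extending partial colourings

_[_↦_] : ∀ {m} {A : Set} → (Fin m → A) → Fin m → A → Fin m → A
(f [ v ↦ x ]) w = if does (w Fin.≟ v) then x else f w

-- Here `j` is `k - 1`, so both `k` and the palette size `N` are positive: factors `k` can be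
-- cancelled, and colour `zero` is available as a default.
module Extension (G : Graph) (j M : ℕ) where

  private
    k N : ℕ
    k = suc j
    N = suc M

    V : Set
    V = Fin (n G)

  -- out: not in the current graph.
  data Status : Set where
    out  : Status
    pre  : Fin N → Status
    free : Subset N → Status

  isIn : Status → Bool
  isIn out = false
  isIn _   = true

  isFree : Status → Bool
  isFree (free _) = true
  isFree _        = false

  preColour : Status → Maybe (Fin N)
  preColour (pre c) = just c
  preColour _       = nothing

  weight : Status → ℕ
  weight out      = 0
  weight (pre _)  = k
  weight (free L) = 4 * k ∸ ∣ L ∣

  -- The termination measure: precolouring a free vertex lowers it, and so does deleting any vertex.
  cost : Status → ℕ
  cost out      = 0
  cost (pre _)  = 1
  cost (free _) = 2

  Respects : Status → Fin N → Set
  Respects out      c = Unit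
  Respects (pre d)  c = c ≡ d
  Respects (free L) c = c ∈ L

  record Valid (σ : V → Status) : Set where
    field
      long   : ∀ v {L} → σ v ≡ free L → 3 * k ≤ ∣ L ∣
      proper : ∀ u v {c d} → T (adj G u v) → σ u ≡ pre c → σ v ≡ pre d → c ≢ d
      light  : sum (weight ∘ σ) ≤ 2 * k * k

  record Colouring (σ : V → Status) : Set where
    field
      colour   : V → Fin N
      respects : ∀ v → Respects (σ v) (colour v)
      proper   : ∀ u v → T (adj G u v) → isIn (σ u) ≡ true → isIn (σ v) ≡ true →
                 colour u ≢ colour v

  free⇒in : ∀ {s} → isFree s ≡ true → isIn s ≡ true
  free⇒in {free _} _ = refl

  isFree-free : ∀ {s} → isFree s ≡ true → ∃ λ L → s ≡ free L
  isFree-free {free L} _ = L , refl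

  -- One inductive step in isolation; `rec` is the induction hypothesis for assignments of smaller
  -- total `cost`.
  module Step (σ : V → Status) (valid : Valid σ)
    (rec : ∀ τ → Valid τ → sum (cost ∘ τ) < sum (cost ∘ σ) → Colouring τ) where

    open Valid valid

    -- Reductions at a single vertex and the trivial cases.

    adj⇒≢ : ∀ {u v} → T (adj G u v) → u ≢ v
    adj⇒≢ e refl = irrefl G _ e

    -- Every precoloured vertex contributes `k` to a total weight of at most `2 * k * k`.
    few-pre : sum (indicator ∘ is-just ∘ preColour ∘ σ) ≤ 2 * k
    few-pre = ℕ.*-cancelʳ-≤ _ _ k (begin
      sum (indicator ∘ is-just ∘ preColour ∘ σ) * k
        ≡⟨ *-distribʳ-sum k (indicator ∘ is-just ∘ preColour ∘ σ) ⟩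
      sum (λ v → indicator (is-just (preColour (σ v))) * k)
        ≤⟨ sum-mono (λ v → pointwise (σ v)) ⟩
      sum (weight ∘ σ)
        ≤⟨ light ⟩
      2 * k * k ∎)
      where
      open ℕ.≤-Reasoning
      pointwise : ∀ s → indicator (is-just (preColour s)) * k ≤ weight s
      pointwise out      = z≤n
      pointwise (pre _)  = ℕ.≤-reflexive (ℕ.*-identityˡ k)
      pointwise (free _) = z≤n

    -- The list has at least `3 * k` colours and at most `2 * k` vertices are precoloured, so some
    -- colour of `L` differs from every precolour in the graph. The new weight `k` is covered by the
    -- old deficit, which is at least `4 * k - 3 * k`.
    colour-tight : ∀ v {L} → σ v ≡ free L → ∣ L ∣ ≤ 3 * k → Colouring σ
    colour-tight v {L} σv tight
      with c , c∈L , fresh ← pick-avoiding (preColour ∘ σ) L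
        (ℕ.≤-<-trans few-pre (ℕ.<-≤-trans (ℕ.*-monoˡ-< k {2} {3} ℕ.≤-refl) (long v σv)))
      = record
      { colour   = colour
      ; respects = λ w → respects-σ w (respects w)
      ; proper   = λ u w e inu inw → proper-τ u w e (in-τ u inu) (in-τ w inw)
      }
      where
      τ = σ [ v ↦ pre c ]

      fresh′ : ∀ w {d} → σ w ≡ pre d → d ≢ c
      fresh′ w σw refl = fresh w (cong preColour σw)

      weight-τ : ∀ w → weight (τ w) ≤ weight (σ w)
      weight-τ w with w Fin.≟ v
      ... | no _ = ℕ.≤-refl
      ... | yes refl rewrite σv = ℕ.≤-trans (ℕ.≤-reflexive (≡.sym (ℕ.m+n∸n≡m k (3 * k))))
                                            (ℕ.∸-monoʳ-≤ (4 * k) tight)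

      cost-τ : ∀ w → cost (τ w) ≤ cost (σ w)
      cost-τ w with w Fin.≟ v
      ... | no _ = ℕ.≤-refl
      ... | yes refl rewrite σv = s≤s z≤n

      cost-τ-v : cost (τ v) < cost (σ v)
      cost-τ-v with v Fin.≟ v
      ... | no v≢v = contradiction refl v≢v
      ... | yes _ rewrite σv = ℕ.≤-refl

      valid-τ : Valid τ
      valid-τ .Valid.long w eq with w Fin.≟ v
      ... | no _ = long w eq
      valid-τ .Valid.proper u w e σu σw with u Fin.≟ v | w Fin.≟ v
      ... | no _     | no _     = proper u w e σu σw
      valid-τ .Valid.proper u w e σu refl | no _     | yes refl = fresh′ u σu
      valid-τ .Valid.proper u w e refl σw | yes refl | no _     = fresh′ w σw ∘ ≡.sym
      ... | yes refl | yes refl = contradiction refl (adj⇒≢ e)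
      valid-τ .Valid.light = ℕ.≤-trans (sum-mono weight-τ) light

      open Colouring (rec τ valid-τ (sum-mono-< cost-τ v cost-τ-v)) renaming (proper to proper-τ)

      respects-σ : ∀ w {x} → Respects (τ w) x → Respects (σ w) x
      respects-σ w r with w Fin.≟ v
      ... | no _ = r
      respects-σ w refl | yes refl rewrite σv = c∈L

      in-τ : ∀ w → isIn (σ w) ≡ true → isIn (τ w) ≡ true
      in-τ w inw with w Fin.≟ v
      ... | no _  = inw
      ... | yes _ = refl

    freeNeighbour : V → V → Bool
    freeNeighbour x w = adj G x w ∧ isFree (σ w)

    freeDegree : V → ℕ
    freeDegree x = sum (indicator ∘ freeNeighbour x)

    strike : Fin N → Status → Status
    strike c (free L) = free (L - c)
    strike c s        = s

    -- By `loose`, a list that loses `c` still has `3 * k` colours. Deleting `x` releases weight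
    -- `k`, while each of its fewer than `k` free neighbours gains at most 1.
    delete-low : (∀ v {L} → σ v ≡ free L → 3 * k < ∣ L ∣) →
                 ∀ x {c} → σ x ≡ pre c → freeDegree x < k → Colouring σ
    delete-low loose x {c} σx low = record
      { colour   = colour [ x ↦ c ]
      ; respects = respects-σ
      ; proper   = proper-σ
      }
      where
      τ : V → Status
      τ = (λ w → if adj G x w then strike c (σ w) else σ w) [ x ↦ out ]

      -- The `+ 0` is what the second summand on the left of `weight-τ` reduces to at vertices other
      -- than `x`.
      weight-strike : ∀ s → weight (strike c s) + 0 ≤ weight s + indicator (isFree s)
      weight-strike out      = z≤n
      weight-strike (pre _)  = ℕ.≤-refl
      weight-strike (free L) = begin
        4 * k ∸ ∣ L - c ∣ + 0                     ≡⟨ ℕ.+-identityʳ _ ⟩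
        4 * k ∸ ∣ L - c ∣                         ≤⟨ ℕ.m≤n+o⇒m∸n≤o (4 * k) ∣ L - c ∣ (begin
          4 * k                                   ≤⟨ ℕ.m≤n+m∸n (4 * k) ∣ L ∣ ⟩
          ∣ L ∣ + (4 * k ∸ ∣ L ∣)                 ≤⟨ ℕ.+-monoˡ-≤ _ (∣p∣≤1+∣p-x∣ L c) ⟩
          suc (∣ L - c ∣ + (4 * k ∸ ∣ L ∣))       ≡⟨ ℕ.+-suc ∣ L - c ∣ _ ⟨
          ∣ L - c ∣ + suc (4 * k ∸ ∣ L ∣)         ≡⟨ cong (∣ L - c ∣ +_) (ℕ.+-comm 1 _) ⟩
          ∣ L - c ∣ + (4 * k ∸ ∣ L ∣ + 1)         ∎) ⟩
        4 * k ∸ ∣ L ∣ + 1                         ∎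
        where open ℕ.≤-Reasoning

      -- Stated without subtraction, so that summing over `w` gives the new weight plus `k` on the
      -- left and the old weight plus `freeDegree x` on the right.
      weight-τ : ∀ w → weight (τ w) + indicator (does (w Fin.≟ x)) * k
                       ≤ weight (σ w) + indicator (freeNeighbour x w)
      weight-τ w with w Fin.≟ x
      ... | yes refl rewrite σx = ℕ.≤-trans (ℕ.≤-reflexive (ℕ.*-identityˡ k)) (ℕ.m≤m+n k _)
      ... | no _ with adj G x w
      ...   | true  = weight-strike (σ w)
      ...   | false = ℕ.≤-refl

      light-τ : sum (weight ∘ τ) ≤ sum (weight ∘ σ)
      light-τ = ℕ.+-cancelʳ-≤ k _ _ (begin
        sum (weight ∘ τ) + k
          ≤⟨ ℕ.+-monoʳ-≤ (sum (weight ∘ τ)) k≤sum ⟩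
        sum (weight ∘ τ) + sum (λ w → indicator (does (w Fin.≟ x)) * k)
          ≡⟨ ∑-distrib-+ (weight ∘ τ) _ ⟨
        sum (λ w → weight (τ w) + indicator (does (w Fin.≟ x)) * k)
          ≤⟨ sum-mono weight-τ ⟩
        sum (λ w → weight (σ w) + indicator (freeNeighbour x w))
          ≡⟨ ∑-distrib-+ (weight ∘ σ) _ ⟩
        sum (weight ∘ σ) + freeDegree x
          ≤⟨ ℕ.+-monoʳ-≤ (sum (weight ∘ σ)) (ℕ.<⇒≤ low) ⟩
        sum (weight ∘ σ) + k ∎)
        where
        open ℕ.≤-Reasoning
        at-x : k ≤ indicator (does (x Fin.≟ x)) * k
        at-x with x Fin.≟ x
        ... | yes _   = ℕ.≤-reflexive (≡.sym (ℕ.*-identityˡ k))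
        ... | no  x≢x = contradiction refl x≢x
        k≤sum : k ≤ sum (λ w → indicator (does (w Fin.≟ x)) * k)
        k≤sum = ℕ.≤-trans at-x (term≤sum (λ w → indicator (does (w Fin.≟ x)) * k) x)

      cost-strike : ∀ s → cost (strike c s) ≤ cost s
      cost-strike out      = ℕ.≤-refl
      cost-strike (pre _)  = ℕ.≤-refl
      cost-strike (free _) = ℕ.≤-refl

      cost-τ : ∀ w → cost (τ w) ≤ cost (σ w)
      cost-τ w with w Fin.≟ x
      ... | yes _ = z≤n
      ... | no _ with adj G x w
      ...   | true  = cost-strike (σ w)
      ...   | false = ℕ.≤-refl

      cost-τ-x : cost (τ x) < cost (σ x)
      cost-τ-x with x Fin.≟ x
      ... | no x≢x = contradiction refl x≢x
      ... | yes _ rewrite σx = ℕ.≤-refl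

      pre-τ : ∀ w {d} → τ w ≡ pre d → σ w ≡ pre d
      pre-τ w eq with w Fin.≟ x
      ... | no _ with adj G x w
      ...   | false = eq
      ...   | true with σ w
      ...     | pre _ = eq

      valid-τ : Valid τ
      valid-τ .Valid.long w eq with w Fin.≟ x
      ... | no _ with adj G x w
      ...   | false = long w eq
      ...   | true with σ w in σw
      valid-τ .Valid.long w refl | no _ | true | free L =
        ℕ.≤-pred (ℕ.≤-trans (loose w σw) (∣p∣≤1+∣p-x∣ L c))
      valid-τ .Valid.proper u w e τu τw = proper u w e (pre-τ u τu) (pre-τ w τw)
      valid-τ .Valid.light = ℕ.≤-trans light-τ light

      open Colouring (rec τ valid-τ (sum-mono-< cost-τ x cost-τ-x)) renaming (proper to proper-τ)

      respects-strike : ∀ s {d} → Respects (strike c s) d → Respects s d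
      respects-strike out      r = r
      respects-strike (pre _)  r = r
      respects-strike (free L) r = Subset.p─q⊆p L ⁅ c ⁆ r

      respects-σ : ∀ w → Respects (σ w) ((colour [ x ↦ c ]) w)
      respects-σ w with w Fin.≟ x | respects w
      ... | yes refl | _ rewrite σx = refl
      ... | no _     | r with adj G x w
      ...   | true  = respects-strike (σ w) r
      ...   | false = r

      -- A precoloured neighbour differs from `c` by validity of `σ`; a free one had `c` struck from
      -- its list.
      clash : ∀ w → T (adj G x w) → isIn (σ w) ≡ true → colour w ≢ c
      clash w e inw with w Fin.≟ x | respects w
      ... | yes refl | _ = contradiction refl (adj⇒≢ e)
      ... | no _     | r with adj G x w in xw
      ...   | true with σ w in σw
      ...     | pre d  = λ eq → proper x w (subst T (≡.sym xw) _) σx σw (trans (≡.sym eq) r)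
      ...     | free L = λ eq → x∉p-x L c (subst (_∈ L - c) eq r)

      in-strike : ∀ s → isIn s ≡ true → isIn (strike c s) ≡ true
      in-strike (pre _)  _ = refl
      in-strike (free _) _ = refl

      in-τ : ∀ w → w ≢ x → isIn (σ w) ≡ true → isIn (τ w) ≡ true
      in-τ w w≢x inw with w Fin.≟ x
      ... | yes w≡x = contradiction w≡x w≢x
      ... | no _ with adj G x w
      ...   | true  = in-strike (σ w) inw
      ...   | false = inw

      proper-σ : ∀ u w → T (adj G u w) → isIn (σ u) ≡ true → isIn (σ w) ≡ true →
                 (colour [ x ↦ c ]) u ≢ (colour [ x ↦ c ]) w
      proper-σ u w e inu inw with u Fin.≟ x | w Fin.≟ x
      ... | yes refl | yes refl = contradiction refl (adj⇒≢ e)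
      ... | yes refl | no _     = clash w e inw ∘ ≡.sym
      ... | no _     | yes refl = clash u (sym G _ _ e) inu
      ... | no u≢x   | no w≢x   = proper-τ u w e (in-τ u u≢x inu) (in-τ w w≢x inw)

    all-coloured : (∀ v → isFree (σ v) ≢ true) → Colouring σ
    all-coloured no-free = record
      { colour   = fromPre ∘ σ
      ; respects = respects-σ
      ; proper   = proper-σ
      }
      where
      fromPre : Status → Fin N
      fromPre (pre c) = c
      -- Only vertices outside the current graph receive this default, and nothing is required of
      -- them.
      fromPre _       = zero

      respects-σ : ∀ v → Respects (σ v) (fromPre (σ v))
      respects-σ v with σ v in σv
      ... | out    = tt
      ... | pre _  = refl
      ... | free _ = contradiction (cong isFree σv) (no-free v)

      proper-σ : ∀ u v → T (adj G u v) → isIn (σ u) ≡ true → isIn (σ v) ≡ true →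
                 fromPre (σ u) ≢ fromPre (σ v)
      proper-σ u v e inu inv with σ u in σu | σ v in σv
      ... | pre c  | pre d  = proper u v e σu σv
      ... | free _ | _      = contradiction (cong isFree σu) (no-free u)
      ... | pre _  | free _ = contradiction (cong isFree σv) (no-free v)

    -- Colour the graph without `v` first: fewer than `k` vertices remain there, so their colours
    -- cannot exhaust `L`.
    greedy : ∀ v {L} → σ v ≡ free L → sum (indicator ∘ isIn ∘ σ) ≤ k → Colouring σ
    greedy v {L} σv few = record
      { colour   = colour [ v ↦ c ]
      ; respects = respects-σ
      ; proper   = proper-σ
      }
      where
      τ = σ [ v ↦ out ]

      τ-≤ : (f : Status → ℕ) → f out ≡ 0 → ∀ w → f (τ w) ≤ f (σ w)
      τ-≤ f f0 w with w Fin.≟ v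
      ... | yes _ = subst (_≤ f (σ w)) (≡.sym f0) z≤n
      ... | no _  = ℕ.≤-refl

      τ-< : (f : Status → ℕ) → f out ≡ 0 → 0 < f (free L) → f (τ v) < f (σ v)
      τ-< f f0 pos with v Fin.≟ v
      ... | yes _ rewrite σv | f0 = pos
      ... | no v≢v = contradiction refl v≢v

      τ≡σ : ∀ w {s} → s ≢ out → τ w ≡ s → σ w ≡ s
      τ≡σ w s≢out eq with w Fin.≟ v
      ... | yes _ = contradiction (≡.sym eq) s≢out
      ... | no _  = eq

      valid-τ : Valid τ
      valid-τ .Valid.long w eq = long w (τ≡σ w (λ ()) eq)
      valid-τ .Valid.proper u w e τu τw = proper u w e (τ≡σ u (λ ()) τu) (τ≡σ w (λ ()) τw)
      valid-τ .Valid.light = ℕ.≤-trans (sum-mono (τ-≤ weight refl)) light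

      open Colouring (rec τ valid-τ (sum-mono-< (τ-≤ cost refl) v (τ-< cost refl (s≤s z≤n))))
        renaming (proper to proper-τ)

      used : V → Maybe (Fin N)
      used w = if isIn (τ w) then just (colour w) else nothing

      is-just-used : ∀ w → indicator (is-just (used w)) ≤ indicator (isIn (τ w))
      is-just-used w with isIn (τ w)
      ... | true  = ℕ.≤-refl
      ... | false = ℕ.≤-refl

      few-used : sum (indicator ∘ is-just ∘ used) < ∣ L ∣
      few-used = begin-strict
        sum (indicator ∘ is-just ∘ used) ≤⟨ sum-mono is-just-used ⟩
        sum (indicator ∘ isIn ∘ τ)       <⟨ sum-mono-< (τ-≤ (indicator ∘ isIn) refl) v
                                              (τ-< (indicator ∘ isIn) refl (s≤s z≤n)) ⟩
        sum (indicator ∘ isIn ∘ σ)       ≤⟨ few ⟩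
        k                                ≤⟨ ℕ.m≤m+n k _ ⟩
        3 * k                            ≤⟨ long v σv ⟩
        ∣ L ∣                            ∎
        where open ℕ.≤-Reasoning

      picked = pick-avoiding used L few-used
      c = proj₁ picked

      respects-σ : ∀ w → Respects (σ w) ((colour [ v ↦ c ]) w)
      respects-σ w with w Fin.≟ v | respects w
      ... | yes refl | _ = subst (λ s → Respects s c) (≡.sym σv) (proj₁ (proj₂ picked))
      ... | no _     | r = r

      in-τ : ∀ w → w ≢ v → isIn (σ w) ≡ true → isIn (τ w) ≡ true
      in-τ w w≢v inw with w Fin.≟ v
      ... | yes w≡v = contradiction w≡v w≢v
      ... | no _    = inw

      fresh : ∀ w → w ≢ v → isIn (σ w) ≡ true → colour w ≢ c
      fresh w w≢v inw eq = proj₂ (proj₂ picked) w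
        (trans (cong (if_then just (colour w) else nothing) (in-τ w w≢v inw)) (cong just eq))

      proper-σ : ∀ u w → T (adj G u w) → isIn (σ u) ≡ true → isIn (σ w) ≡ true →
                 (colour [ v ↦ c ]) u ≢ (colour [ v ↦ c ]) w
      proper-σ u w e inu inw with u Fin.≟ v | w Fin.≟ v
      ... | yes refl | yes refl = contradiction refl (adj⇒≢ e)
      ... | yes refl | no w≢v   = fresh w w≢v inw ∘ ≡.sym
      ... | no u≢v   | yes refl = fresh u u≢v inu
      ... | no u≢v   | no w≢v   = proper-τ u w e (in-τ u u≢v inu) (in-τ w w≢v inw)

    -- Gluing along a small separator.

    record Separation (X P : V → Bool) : Set where
      field
        small  : sum (indicator ∘ X) < k
        inner  : ∃ λ u → isIn (σ u) ≡ true × X u ≡ false × P u ≡ true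
        outer  : ∃ λ u → isIn (σ u) ≡ true × X u ≡ false × P u ≡ false
        closed : ∀ a b → T (adj G a b) → isIn (σ a) ≡ true → isIn (σ b) ≡ true →
                 X a ≡ false → X b ≡ false → P a ≡ P b

    -- A side is a Boolean predicate and `closed` is an equality, so negation exchanges the two
    -- sides.
    flip-side : ∀ {X P} → Separation X P → Separation X (not ∘ P)
    flip-side sep = record
      { small  = small
      ; inner  = let u , inu , u∉X , Pu = outer in u , inu , u∉X , cong not Pu
      ; outer  = let u , inu , u∉X , Pu = inner in u , inu , u∉X , cong not Pu
      ; closed = λ a b e ina inb a∉X b∉X → cong not (closed a b e ina inb a∉X b∉X)
      }
      where open Separation sep

    module Separated (high : ∀ x {c} → σ x ≡ pre c → k ≤ freeDegree x) where

      -- A precoloured vertex of the side has at least `k` free neighbours. Fewer than `k` of them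
      -- fit into `X`, and any other lies on the same side by `closed`.
      free-inner : ∀ {X P} → Separation X P →
                   ∃ λ w → isFree (σ w) ≡ true × X w ≡ false × P w ≡ true
      free-inner {X} {P} sep with u , inu , u∉X , Pu ← Separation.inner sep with σ u in σu
      ... | free _ = u , cong isFree σu , u∉X , Pu
      ... | pre _ with Fin.any? (λ w → (freeNeighbour u w Bool.≟ true) ×-dec (X w Bool.≟ false))
      ...   | no none = contradiction (ℕ.≤-trans (high u σu) (sum-mono in-X)) (ℕ.<⇒≱ (Separation.small sep))
        where
        in-X : ∀ w → indicator (freeNeighbour u w) ≤ indicator (X w)
        in-X w with freeNeighbour u w in uw | X w in Xw
        ... | false | _     = z≤n
        ... | true  | true  = ℕ.≤-refl
        ... | true  | false = contradiction (w , uw , Xw) none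
      ...   | yes (w , uw , w∉X) with adj G u w in e
      ...     | true = w , uw , w∉X ,
        trans (≡.sym (Separation.closed sep u w (subst T (≡.sym e) _) (cong isIn σu)
                        (free⇒in uw) u∉X w∉X)) Pu

      side : (X P : V → Bool) → V → Bool
      side X P w = not (X w) ∧ P w

      sideWeight : (X P : V → Bool) → ℕ
      sideWeight X P = sum (λ w → indicator (side X P w) * weight (σ w))

      -- The precoloured vertices of the light side stay in the first graph, so that the new
      -- colours on X do not clash with them.
      glue : ∀ {X P} → Separation X P → sideWeight X P ≤ k * k → Colouring σ
      glue {X} {P} sep half = record
        { colour   = colour
        ; respects = respects-σ
        ; proper   = proper-σ
        }
        where
        open Separation sep

        D : V → Bool
        D = side X P

        inD : ∀ {w} → X w ≡ false → P w ≡ true → D w ≡ true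
        inD w∉X Pw rewrite w∉X = Pw

        notD : ∀ {w} → P w ≡ false → D w ≡ false
        notD {w} Pw = trans (cong (not (X w) ∧_) Pw) (Bool.∧-zeroʳ _)

        σ₁ : V → Status
        σ₁ w = if D w ∧ isFree (σ w) then out else σ w

        σ₁≡σ : ∀ w {s} → s ≢ out → σ₁ w ≡ s → σ w ≡ s
        σ₁≡σ w s≢out eq with D w ∧ isFree (σ w)
        ... | true  = contradiction (≡.sym eq) s≢out
        ... | false = eq

        σ₁-≤ : (f : Status → ℕ) → f out ≡ 0 → ∀ w → f (σ₁ w) ≤ f (σ w)
        σ₁-≤ f f0 w with D w ∧ isFree (σ w)
        ... | true  = subst (_≤ f (σ w)) (≡.sym f0) z≤n
        ... | false = ℕ.≤-refl

        valid₁ : Valid σ₁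
        valid₁ .Valid.long w eq = long w (σ₁≡σ w (λ ()) eq)
        valid₁ .Valid.proper u w e σu σw = proper u w e (σ₁≡σ u (λ ()) σu) (σ₁≡σ w (λ ()) σw)
        valid₁ .Valid.light = ℕ.≤-trans (sum-mono (σ₁-≤ weight refl)) light

        -- A free vertex inside `D` has been dropped from the first graph.
        smaller₁ : sum (cost ∘ σ₁) < sum (cost ∘ σ)
        smaller₁ with w , w-free , w∉X , Pw ← free-inner sep
          = sum-mono-< (σ₁-≤ cost refl) w (at-w w-free (inD w∉X Pw))
          where
          at-w : isFree (σ w) ≡ true → D w ≡ true → cost (σ₁ w) < cost (σ w)
          at-w w-free Dw rewrite Dw with free L ← σ w = s≤s z≤n

        open Colouring (rec σ₁ valid₁ smaller₁)
          renaming (colour to colour₁; respects to respects₁; proper to proper₁)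

        σ₁-D : ∀ w → D w ≡ false → σ₁ w ≡ σ w
        σ₁-D w Dw rewrite Dw = refl

        σ₁-pre : ∀ w {c} → σ w ≡ pre c → colour₁ w ≡ c × isIn (σ₁ w) ≡ true
        σ₁-pre w σw with respects₁ w
        ... | r rewrite σw | Bool.∧-zeroʳ (D w) = r , refl

        fix : Fin N → Status → Status
        fix c out = out
        fix c _   = pre c

        σ₂ : V → Status
        σ₂ w = if D w then σ w else (if X w then fix (colour₁ w) (σ w) else out)

        -- `1 * k` is what the bound in `weight₂` reduces to on `X`.
        fix-weight : ∀ c s → weight (fix c s) ≤ 1 * k
        fix-weight c out      = z≤n
        fix-weight c (pre _)  = ℕ.≤-reflexive (≡.sym (ℕ.*-identityˡ k))
        fix-weight c (free _) = ℕ.≤-reflexive (≡.sym (ℕ.*-identityˡ k))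

        fix-cost : ∀ c s → cost (fix c s) ≤ cost s
        fix-cost c out      = ℕ.≤-refl
        fix-cost c (pre _)  = ℕ.≤-refl
        fix-cost c (free _) = s≤s z≤n

        weight₂ : ∀ w → weight (σ₂ w) ≤ indicator (D w) * weight (σ w) + indicator (X w) * k
        weight₂ w with D w
        ... | true = ℕ.≤-trans (ℕ.≤-reflexive (≡.sym (ℕ.*-identityˡ (weight (σ w))))) (ℕ.m≤m+n _ _)
        ... | false with X w
        ...   | true  = fix-weight (colour₁ w) (σ w)
        ...   | false = z≤n

        light₂ : sum (weight ∘ σ₂) ≤ 2 * k * k
        light₂ = begin
          sum (weight ∘ σ₂)
            ≤⟨ sum-mono weight₂ ⟩
          sum (λ w → indicator (D w) * weight (σ w) + indicator (X w) * k)
            ≡⟨ ∑-distrib-+ (λ w → indicator (D w) * weight (σ w)) _ ⟩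
          sideWeight X P + sum (λ w → indicator (X w) * k)
            ≡⟨ cong (sideWeight X P +_) (*-distribʳ-sum k (indicator ∘ X)) ⟨
          sideWeight X P + sum (indicator ∘ X) * k
            ≤⟨ ℕ.+-mono-≤ half (ℕ.*-monoˡ-≤ k (ℕ.<⇒≤ small)) ⟩
          k * k + k * k
            ≡⟨ ℕ.*-distribʳ-+ k k k ⟨
          (k + k) * k
            ≡⟨ cong (λ x → (k + x) * k) (ℕ.+-identityʳ k) ⟨
          2 * k * k ∎
          where open ℕ.≤-Reasoning

        cost₂ : ∀ w → cost (σ₂ w) ≤ cost (σ w)
        cost₂ w with D w
        ... | true = ℕ.≤-refl
        ... | false with X w
        ...   | true  = fix-cost (colour₁ w) (σ w)
        ...   | false = z≤n

        -- A free vertex on the far side of the separator has been dropped from the second graph.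
        smaller₂ : sum (cost ∘ σ₂) < sum (cost ∘ σ)
        smaller₂ with w , w-free , w∉X , Pw ← free-inner (flip-side sep)
          = sum-mono-< cost₂ w (at-w w-free w∉X (notD (Bool.not-injective Pw)))
          where
          at-w : isFree (σ w) ≡ true → X w ≡ false → D w ≡ false → cost (σ₂ w) < cost (σ w)
          at-w w-free Xw Dw rewrite Dw | Xw with free L ← σ w = s≤s z≤n

        σ₂-D : ∀ w → D w ≡ true → σ₂ w ≡ σ w
        σ₂-D w Dw rewrite Dw = refl

        pre₂-X : ∀ w {c} → D w ≡ false → σ₂ w ≡ pre c → colour₁ w ≡ c × isIn (σ w) ≡ true
        pre₂-X w Dw eq rewrite Dw with X w
        ... | true with σ w
        pre₂-X w Dw refl | true | pre _  = refl , refl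
        pre₂-X w Dw refl | true | free _ = refl , refl

        -- Every precolour in `σ₂`, old or new, is the colour that the first colouring gives to a
        -- vertex of its graph. Properness of the precolouring is therefore inherited from
        -- `proper₁`.
        pre₂ : ∀ w {c} → σ₂ w ≡ pre c → colour₁ w ≡ c × isIn (σ₁ w) ≡ true
        pre₂ w eq = case D w Bool.≟ true of λ where
          (yes Dw) → σ₁-pre w (trans (≡.sym (σ₂-D w Dw)) eq)
          (no ¬Dw) → let Dw = Bool.¬-not ¬Dw ; eq′ , inw = pre₂-X w Dw eq in
            eq′ , trans (cong isIn (σ₁-D w Dw)) inw

        valid₂ : Valid σ₂
        valid₂ .Valid.long w eq with D w
        ... | true = long w eq
        ... | false with X w
        ...   | true with σ w
        valid₂ .Valid.long w () | false | true | out
        valid₂ .Valid.proper u w e σu σw with pre₂ u σu | pre₂ w σw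
        ... | refl , inu | refl , inw = proper₁ u w e inu inw
        valid₂ .Valid.light = light₂

        open Colouring (rec σ₂ valid₂ smaller₂)
          renaming (colour to colour₂; respects to respects₂; proper to proper₂)

        colour : V → Fin N
        colour w = if D w then colour₂ w else colour₁ w

        respects-σ : ∀ w → Respects (σ w) (colour w)
        respects-σ w with D w | respects₁ w | respects₂ w
        ... | true  | _  | r₂ = r₂
        ... | false | r₁ | _  = r₁

        -- A neighbour b of D outside D lies in X, where the two colourings agree.
        crossing : ∀ a b → T (adj G a b) → isIn (σ a) ≡ true → isIn (σ b) ≡ true →
                   D a ≡ true → D b ≡ false → colour₂ a ≢ colour₁ b
        crossing a b e ina inb Da Db = subst (colour₂ a ≢_) agree
          (proper₂ a b e (trans (cong isIn (σ₂-D a Da)) ina) (cong isIn σ₂b))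
          where
          Xb : X b ≡ true
          Xb with X a in Xa | X b in Xb
          ... | _     | true  = refl
          ... | false | false = case trans (≡.sym Db) (trans (≡.sym (closed a b e ina inb Xa Xb)) Da) of λ ()

          fixed : ∀ c s → isIn s ≡ true → fix c s ≡ pre c
          fixed c (pre _)  _ = refl
          fixed c (free _) _ = refl

          σ₂b : σ₂ b ≡ pre (colour₁ b)
          σ₂b rewrite Db | Xb = fixed (colour₁ b) (σ b) inb

          agree : colour₂ b ≡ colour₁ b
          agree = subst (λ s → Respects s (colour₂ b)) σ₂b (respects₂ b)

        proper-σ : ∀ a b → T (adj G a b) → isIn (σ a) ≡ true → isIn (σ b) ≡ true →
                   colour a ≢ colour b
        proper-σ a b e ina inb = helper (D a) (D b) refl refl
          where
          in₁ : ∀ w → D w ≡ false → isIn (σ w) ≡ true → isIn (σ₁ w) ≡ true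
          in₁ w Dw inw = trans (cong isIn (σ₁-D w Dw)) inw

          in₂ : ∀ w → D w ≡ true → isIn (σ w) ≡ true → isIn (σ₂ w) ≡ true
          in₂ w Dw inw = trans (cong isIn (σ₂-D w Dw)) inw

          helper : ∀ x y → D a ≡ x → D b ≡ y →
                   (if x then colour₂ a else colour₁ a) ≢ (if y then colour₂ b else colour₁ b)
          helper true  true  Da Db = proper₂ a b e (in₂ a Da ina) (in₂ b Db inb)
          helper true  false Da Db = crossing a b e ina inb Da Db
          helper false true  Da Db = crossing b a (sym G a b e) inb ina Db Da ∘ ≡.sym
          helper false false Da Db = proper₁ a b e (in₁ a Da ina) (in₁ b Db inb)

      sides-disjoint : ∀ X P → sideWeight X P + sideWeight X (not ∘ P) ≤ sum (weight ∘ σ)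
      sides-disjoint X P = ℕ.≤-trans
        (ℕ.≤-reflexive (≡.sym (∑-distrib-+ (λ w → indicator (side X P w) * weight (σ w)) _)))
        (sum-mono pointwise)
        where
        pointwise : ∀ w → indicator (side X P w) * weight (σ w) +
                          indicator (side X (not ∘ P) w) * weight (σ w) ≤ weight (σ w)
        pointwise w with X w | P w
        ... | true  | _     = z≤n
        ... | false | true  = ℕ.≤-reflexive (trans (ℕ.+-identityʳ _) (ℕ.*-identityˡ (weight (σ w))))
        ... | false | false = ℕ.≤-reflexive (ℕ.*-identityˡ (weight (σ w)))

      separate : ∀ {X P} → Separation X P → Colouring σ
      separate {X} {P} sep with sideWeight X P ≤? k * k
      ... | yes light-P = glue sep light-P
      -- The two sides share a weight of at most `2 * k * k`, so the other side is the light one.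
      ... | no  heavy-P = glue (flip-side sep) (ℕ.+-cancelˡ-≤ (k * k) _ _ (begin
        k * k + sideWeight X (not ∘ P)            ≤⟨ ℕ.+-monoˡ-≤ _ (ℕ.<⇒≤ (ℕ.≰⇒> heavy-P)) ⟩
        sideWeight X P + sideWeight X (not ∘ P)   ≤⟨ sides-disjoint X P ⟩
        sum (weight ∘ σ)                          ≤⟨ light ⟩
        2 * k * k                                 ≡⟨ cong (λ x → (k + x) * k) (ℕ.+-identityʳ k) ⟩
        (k + k) * k                               ≡⟨ ℕ.*-distribʳ-+ k k k ⟩
        k * k + k * k                             ∎))
        where open ℕ.≤-Reasoning

    -- The induced current graph: its cuts and its choosability.

    W : Subset (n G)
    W = tabulate (isIn ∘ σ)

    H : Graph
    H = induced G W

    in-W : ∀ v → isIn (σ v) ≡ true → ∃ λ i → embed W i ≡ v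
    in-W v inv = embed-surjective W (∈-tabulate inv)

    -- One-way closure in the cut becomes equality of sides by using each edge in both directions.
    cut-separation : Cut H k → ∃ λ X → ∃ λ P → Separation X P
    cut-separation (X , C , small , (u , u∉X , u∈C) , (v , v∉X , v∉C) , closed) =
      lookup (push W X) , lookup (push W C) , record
      { small  = subst (_< k) (trans (≡.sym (∣push∣ W X)) (∣p∣≡sum (push W X))) small
      ; inner  = embed W u , ∈-tabulate⁻ (embed-∈ W u) , pushed X u u∉X , pushed C u u∈C
      ; outer  = embed W v , ∈-tabulate⁻ (embed-∈ W v) , pushed X v v∉X , pushed C v v∉C
      ; closed = λ a b e ina inb a∉X b∉X → same a b e (in-W a ina) (in-W b inb) a∉X b∉X
      }
      where
      pushed : ∀ (Y : Subset ∣ W ∣) i {b} → lookup Y i ≡ b → lookup (push W Y) (embed W i) ≡ b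
      pushed Y i = trans (lookup-push W Y i)

      pulled : ∀ (Y : Subset ∣ W ∣) i {b} → lookup (push W Y) (embed W i) ≡ b → lookup Y i ≡ b
      pulled Y i = trans (≡.sym (lookup-push W Y i))

      same : ∀ a b → T (adj G a b) → (∃ λ i → embed W i ≡ a) → (∃ λ i → embed W i ≡ b) →
             lookup (push W X) a ≡ false → lookup (push W X) b ≡ false →
             lookup (push W C) a ≡ lookup (push W C) b
      same _ _ e (i , refl) (i′ , refl) a∉X b∉X
        with lookup C i in Ci | lookup C i′ in Ci′
      ... | true  | true  = trans (pushed C i Ci) (≡.sym (pushed C i′ Ci′))
      ... | false | false = trans (pushed C i Ci) (≡.sym (pushed C i′ Ci′))
      ... | true  | false = case trans (≡.sym (closed i i′ e (pulled X i a∉X) (pulled X i′ b∉X) Ci)) Ci′ of λ ()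
      ... | false | true  = case trans (≡.sym (closed i′ i (sym G _ _ e) (pulled X i′ b∉X) (pulled X i a∉X) Ci′)) Ci of λ ()

    -- Removing all precolours leaves each free list at least `3 * k - 2 * k` colours, more than
    -- `j`. Precoloured vertices take part with the full palette, and their chosen colours are then
    -- overwritten; free vertices avoid every precolour, so no clash arises.
    choose-free : ChoosableFrom N H j → (∃ λ v → isFree (σ v) ≡ true) → Colouring σ
    choose-free choosable (v , v-free) = record
      { colour   = colour
      ; respects = respects-σ
      ; proper   = λ a b → proper-from a b (σ a) (σ b) refl refl
      }
      where
      used : V → Maybe (Fin N)
      used = preColour ∘ σ

      palette : Status → Subset N
      palette (free L) = avoid used L
      palette _        = ⊤

      j≤3k : j ≤ 3 * k
      j≤3k = ℕ.≤-trans (ℕ.n≤1+n j) (ℕ.m≤m+n k _)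

      -- The list of the free vertex `v` lies in the palette and bounds its size from below.
      j≤N : j ≤ N
      j≤N with L , σv ← isFree-free v-free = ℕ.≤-trans j≤3k (ℕ.≤-trans (long v σv) (Subset.∣p∣≤n L))

      j≤palette : ∀ w → j ≤ ∣ palette (σ w) ∣
      j≤palette w with σ w in σw
      ... | out    = ℕ.≤-trans j≤N (ℕ.≤-reflexive (≡.sym (Subset.∣⊤∣≡n N)))
      ... | pre _  = ℕ.≤-trans j≤N (ℕ.≤-reflexive (≡.sym (Subset.∣⊤∣≡n N)))
      ... | free L = ℕ.≤-trans (ℕ.n≤1+n j) (ℕ.+-cancelˡ-≤ (2 * k) _ _ (begin
        2 * k + k                    ≡⟨ ℕ.+-comm (2 * k) k ⟩
        3 * k                        ≤⟨ long w σw ⟩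
        ∣ L ∣                        ≤⟨ ∣p∣≤∣avoid∣ used L ⟩
        _ + ∣ avoid used L ∣         ≤⟨ ℕ.+-monoˡ-≤ _ few-pre ⟩
        2 * k + ∣ avoid used L ∣     ∎))
        where open ℕ.≤-Reasoning

      list : V → Fin j → Fin N
      list w a = embed (palette (σ w)) (inject≤ a (j≤palette w))

      lists : Fin (∣ W ∣ * j) → Fin N
      lists x = uncurry (list ∘ embed W) (remQuot j x)

      lists-combine : ∀ i a → lists (combine i a) ≡ list (embed W i) a
      lists-combine i a = cong (uncurry (list ∘ embed W)) (Fin.remQuot-combine i a)

      chosen = choosable lists λ i a b eq →
        Fin.inject≤-injective _ _ a b (embed-injective (palette (σ (embed W i)))
          (trans (≡.sym (lists-combine i a)) (trans eq (lists-combine i b))))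

      index : Fin ∣ W ∣ → Fin j
      index = proj₁ chosen

      hcolour : V → Fin N
      hcolour w with isIn (σ w) Bool.≟ true
      ... | yes inw = let i , _ = in-W w inw in list (embed W i) (index i)
      ... | no  _   = zero

      hcolour-in : ∀ w → isIn (σ w) ≡ true → ∃ λ i → embed W i ≡ w × hcolour w ≡ list (embed W i) (index i)
      hcolour-in w inw with isIn (σ w) Bool.≟ true
      ... | yes inw′ = let i , eq = in-W w inw′ in i , eq , refl
      ... | no  ∉    = contradiction inw ∉

      hcolour-palette : ∀ w → isIn (σ w) ≡ true → hcolour w ∈ palette (σ w)
      hcolour-palette w inw with i , refl , eq ← hcolour-in w inw
        = subst (_∈ palette (σ w)) (≡.sym eq) (embed-∈ (palette (σ w)) _)

      hcolour-proper : ∀ a b → T (adj G a b) → isIn (σ a) ≡ true → isIn (σ b) ≡ true →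
                       hcolour a ≢ hcolour b
      hcolour-proper a b e ina inb eq
        with i , refl , eqa ← hcolour-in a ina | i′ , refl , eqb ← hcolour-in b inb
        = proj₂ chosen i i′ e (trans (lists-combine i (index i))
            (trans (≡.sym eqa) (trans eq (trans eqb (≡.sym (lists-combine i′ (index i′)))))))

      colour : V → Fin N
      colour w = fromMaybe (hcolour w) (preColour (σ w))

      respects-from : ∀ s {c} → (isIn s ≡ true → c ∈ palette s) →
                      Respects s (fromMaybe c (preColour s))
      respects-from out      h = tt
      respects-from (pre _)  h = refl
      respects-from (free L) h = avoid⊆ used L (h refl)

      respects-σ : ∀ w → Respects (σ w) (colour w)
      respects-σ w = respects-from (σ w) (hcolour-palette w)

      unused : ∀ a b {L c} → σ a ≡ free L → σ b ≡ pre c → hcolour a ≢ c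
      unused a b {L} σa σb refl = ∉avoid used L b (cong preColour σb)
        (subst (λ s → hcolour a ∈ palette s) σa (hcolour-palette a (cong isIn σa)))

      proper-from : ∀ a b s t → σ a ≡ s → σ b ≡ t → T (adj G a b) → isIn s ≡ true → isIn t ≡ true →
                    fromMaybe (hcolour a) (preColour s) ≢ fromMaybe (hcolour b) (preColour t)
      proper-from a b (pre _)  (pre _)  σa σb e _ _ = proper a b e σa σb
      proper-from a b (pre _)  (free _) σa σb e _ _ = unused b a σb σa ∘ ≡.sym
      proper-from a b (free _) (pre _)  σa σb e _ _ = unused a b σa σb
      proper-from a b (free _) (free _) σa σb e _ _ =
        hcolour-proper a b e (cong isIn σa) (cong isIn σb)

  -- The case distinction and the induction.

  Tight : Status → Set
  Tight s = ∃ λ L → s ≡ free L × ∣ L ∣ ≤ 3 * k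

  tight? : ∀ s → Dec (Tight s)
  tight? out      = no λ ()
  tight? (pre _)  = no λ ()
  tight? (free L) = map′ (λ tight → L , refl , tight) (λ { (_ , refl , tight) → tight }) (∣ L ∣ ≤? 3 * k)

  pre? : ∀ s → Dec (∃ λ c → s ≡ pre c)
  pre? out      = no λ ()
  pre? (pre c)  = yes (c , refl)
  pre? (free _) = no λ ()

  -- The desired subgraph in decidable form: connectivity as absence of a cut, and failure of
  -- choosability over the fixed palette.
  Good : Graph → Set
  Good H = k < n H × ¬ Cut H k × ¬ ChoosableFrom N H j

  good? : ∀ H → Dec (Good H)
  good? H = (k <? n H) ×-dec ¬? (cut? H k) ×-dec ¬? (choosableFrom? N H j)

  -- Induction on a strict bound `m` for the total cost. The order of cases matters: once no list is
  -- tight, striking a colour is safe; once no precoloured vertex has few free neighbours, both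
  -- sides of a separator contain a free vertex.
  extend : (∀ W → ¬ Good (induced G W)) →
           ∀ m σ → Valid σ → sum (cost ∘ σ) < m → Colouring σ
  extend no-good (suc m) σ valid fuel = result
    where
    open Step σ valid
      (λ τ valid-τ less → extend no-good m τ valid-τ (ℕ.<-≤-trans less (ℕ.≤-pred fuel)))

    result : Colouring σ
    result with Fin.any? (tight? ∘ σ)
    ... | yes (v , L , σv , tight) = colour-tight v σv tight
    ... | no ¬tight with Fin.any? (λ x → pre? (σ x) ×-dec (freeDegree x <? k))
    ... | yes (x , (c , σx) , low) =
      delete-low (λ v σv → ℕ.≰⇒> λ tight → ¬tight (v , _ , σv , tight)) x σx low
    ... | no ¬low with Fin.any? (λ v → isFree (σ v) Bool.≟ true)
    ... | no ¬free = all-coloured λ v v-free → ¬free (v , v-free)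
    ... | yes (v , v-free) with k <? ∣ W ∣
    ... | no ¬big = greedy v (proj₂ (isFree-free v-free))
      (subst (_≤ k) (∣tabulate∣≡sum (isIn ∘ σ)) (ℕ.≮⇒≥ ¬big))
    ... | yes big with cut? H k
    ... | yes cut = Separated.separate
      (λ x σx → ℕ.≮⇒≥ λ low → ¬low (x , (_ , σx) , low)) (proj₂ (proj₂ (cut-separation cut)))
    -- The current graph is large and has no cut, so it can only fail to be `Good` by being
    -- choosable; decidability removes the double negation.
    ... | no ¬cut = choose-free
      (decidable-stable (choosableFrom? N H j) λ ¬ch → no-good W (big , ¬cut , ¬ch)) (v , v-free)

-- Renaming the colours of a list assignment into a palette of bounded size

module Rename {m l} (L : Fin m → List ℕ) (length-L : ∀ v → length (L v) ≡ l) where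

  open import Data.List.Membership.DecPropositional (Fin._≟_ {suc (m * l)})
    using () renaming (_∈?_ to _∈ˡ?_)

  entry : Fin (m * l) → ℕ
  entry x = let v , i = remQuot l x in List.lookup (L v) (cast (≡.sym (length-L v)) i)

  name : Fin (suc (m * l)) → ℕ
  name zero    = 0
  name (suc x) = entry x

  -- The search depends only on the value `c`, so all occurrences of a colour get the position of
  -- one common representative; `zero` marks a colour that does not occur.
  rename : ℕ → Fin (suc (m * l))
  rename c with Fin.any? (λ x → entry x ℕ.≟ c)
  ... | yes (x , _) = suc x
  ... | no _        = zero

  entry-surjective : ∀ v {c} → c ∈ˡ L v → ∃ λ x → entry x ≡ c
  entry-surjective v {c} c∈ = combine v i , (begin
    entry (combine v i)
      ≡⟨ cong (λ (v , i) → List.lookup (L v) (cast (≡.sym (length-L v)) i)) (Fin.remQuot-combine v i) ⟩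
    List.lookup (L v) (cast (≡.sym (length-L v)) i)
      ≡⟨ cong (List.lookup (L v)) (Fin.cast-involutive (≡.sym (length-L v)) (length-L v) _) ⟩
    List.lookup (L v) (Any.index c∈)
      ≡⟨ AnyP.lookup-index c∈ ⟨
    c ∎)
    where
    open ≡.≡-Reasoning
    i = cast (length-L v) (Any.index c∈)

  name-rename : ∀ v {c} → c ∈ˡ L v → name (rename c) ≡ c
  name-rename v {c} c∈ with Fin.any? (λ x → entry x ℕ.≟ c)
  ... | yes (_ , eq) = eq
  ... | no none      = contradiction (entry-surjective v c∈) none

  occurs : Fin m → Fin (suc (m * l)) → Bool
  occurs v x = does (x ∈ˡ? List.map rename (L v))

  renamed : Fin m → Subset (suc (m * l))
  renamed v = tabulate (occurs v)

  renamed⁻ : ∀ v {x} → x ∈ renamed v → ∃ λ c → c ∈ˡ L v × x ≡ rename c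
  renamed⁻ v {x} x∈ with x ∈ˡ? List.map rename (L v) | ∈-tabulate⁻ {b = occurs v} {x} x∈
  ... | yes x∈map | _ = List∈.∈-map⁻ rename x∈map

  name-∈ : ∀ v {x} → x ∈ renamed v → name x ∈ˡ L v
  name-∈ v x∈ with c , c∈ , refl ← renamed⁻ v x∈ = subst (_∈ˡ L v) (≡.sym (name-rename v c∈)) c∈

  -- Membership matters: a colour may occur at several positions, and only its representative is
  -- fixed by the round trip.
  rename-name : ∀ v {x} → x ∈ renamed v → rename (name x) ≡ x
  rename-name v x∈ with c , c∈ , refl ← renamed⁻ v x∈ = cong rename (name-rename v c∈)

  name-injective : ∀ u v {x y} → x ∈ renamed u → y ∈ renamed v → name x ≡ name y → x ≡ y
  name-injective u v {x} {y} x∈ y∈ eq = begin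
    x               ≡⟨ rename-name u x∈ ⟨
    rename (name x) ≡⟨ cong rename eq ⟩
    rename (name y) ≡⟨ rename-name v y∈ ⟩
    y               ∎
    where open ≡.≡-Reasoning

  -- On the lists `name` is a left inverse of `rename`, so distinct colours keep distinct names.
  ∣renamed∣ : ∀ v → Unique (L v) → l ≤ ∣ renamed v ∣
  ∣renamed∣ v unique = subst (_≤ ∣ renamed v ∣) (trans (List.length-map rename (L v)) (length-L v))
    (Unique⇒length≤∣p∣ {p = renamed v} (map-unique (L v) (λ c∈ → c∈) unique) λ {x} x∈ →
      ∈-tabulate {b = occurs v} (dec-true (x ∈ˡ? List.map rename (L v)) x∈))
    where
    map-unique : ∀ cs → (∀ {c} → c ∈ˡ cs → c ∈ˡ L v) → Unique cs → Unique (List.map rename cs)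
    map-unique []       cs⊆ []        = []
    map-unique (c ∷ cs) cs⊆ (c∉ ∷ u) =
      All.tabulate (λ x∈ eq → let d , d∈ , x≡ = List∈.∈-map⁻ rename x∈ in
        All.lookup c∉ d∈ (trans (≡.sym (name-rename v (cs⊆ (here refl))))
          (trans (cong name (trans eq x≡)) (name-rename v (cs⊆ (there d∈))))))
      ∷ map-unique cs (cs⊆ ∘ there) u

-- Applying the extension statement to whole graphs.

module _ (G : Graph) (j : ℕ) where

  private
    k l : ℕ
    k = suc j
    l = 4 * k

  -- This makes `N` equal to the palette size `suc (n G * l)` of `Rename`.
  open Extension G j (n G * l)

  -- Start with every vertex free: lists of size at least `4 * k` have no deficit, so the total
  -- weight is 0. Injectivity of `name` carries properness back to the original colours.
  no-good⇒Choosable : (∀ W → ¬ Good (induced G W)) → Choosable G l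
  no-good⇒Choosable no-good L lists =
    name ∘ colour ,
    (λ v → name-∈ v (respects v)) ,
    λ u v e eq → proper u v e refl refl (name-injective u v (respects u) (respects v) eq)
    where
    open Rename L (proj₁ ∘ lists)

    σ : Fin (n G) → Status
    σ = free ∘ renamed

    valid : Valid σ
    valid = record
      { long   = λ { v refl → ℕ.≤-trans (ℕ.m≤n+m (3 * k) k) (∣renamed∣ v (proj₂ (lists v))) }
      ; proper = λ _ _ _ ()
      ; light  = ℕ.≤-trans (sum-mono λ v → ℕ.≤-reflexive (ℕ.m≤n⇒m∸n≡0 (∣renamed∣ v (proj₂ (lists v)))))
                 (ℕ.≤-trans (ℕ.≤-reflexive (sum-replicate-zero (n G))) z≤n)
      }

    open Colouring (extend no-good _ σ valid ℕ.≤-refl)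

  good⇒KConnected : ∀ {H} → Good H → KConnected H k
  good⇒KConnected (big , ¬cut , _) = big , ¬Cut⇒ConnectedWithout ¬cut

  good⇒ListChromatic≥ : ∀ {H} → Good H → ListChromatic≥ H k
  good⇒ListChromatic≥ {H} (_ , _ , ¬ch) i choosable = ℕ.≮⇒≥ λ i<k →
    ¬ch (Choosable⇒ChoosableFrom {H = H} (Choosable-mono {H} (ℕ.≤-pred i<k) choosable))

theorem1p2 : (k : ℕ) (G : Graph) → ListChromatic≥ G (4 * k + 1) →
    Σ Graph λ H → Subgraph H G × KConnected H k × ListChromatic≥ H k
theorem1p2 zero G χ≥ = G , (id , id , λ _ _ e → e) , (nonempty , λ _ ()) , λ _ _ → z≤n
  where
  -- For `k = 0` the graph itself serves once it has a vertex; without vertices it would be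
  -- 0-choosable, against `χ≥`.
  nonempty : 0 < n G
  nonempty = ℕ.n≢0⇒n>0 λ n≡0 →
    let no-vertex : ¬ Fin (n G)
        no-vertex v = Fin.¬Fin0 (subst Fin n≡0 v)
    in case χ≥ 0 (λ _ _ → ⊥-elim ∘ no-vertex , ⊥-elim ∘ no-vertex , ⊥-elim ∘ no-vertex) of λ ()
theorem1p2 (suc j) G χ≥ with Subset.anySubset? (λ W → Extension.good? G j (n G * (4 * suc j)) (induced G W))
... | yes (W , good) = induced G W , induced-Subgraph G W ,
  good⇒KConnected G j {induced G W} good , good⇒ListChromatic≥ G j {induced G W} good
-- Otherwise `G` is `4 * k`-choosable, and `χ≥` would give `4 * k + 1 ≤ 4 * k`, where `k` is
-- `suc j`.
... | no ¬good = contradiction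
  (χ≥ (4 * suc j) (no-good⇒Choosable G j λ W good → ¬good (W , good)))
  (ℕ.<⇒≱ (ℕ.≤-reflexive (ℕ.+-comm 1 _)))
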